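{- Let $d,r\ge 1$ be integers. There is a number $c(d,r)$, depending only on $d$ and $r$, with $$c(d,r)\le (d+1)\left(\left\lfloor \tfrac d2\right\rfloor+1\right)(r-1)+1,$$ such that the following holds: if $X=\{x_1,x_2,\dots,x_n\}$ is an order-type homogeneous set of $n$ points in $\mathbb{R}^d$ with alternating partition $A_1,\dots,A_r$, and $n\ge c(d,r)$, then $\bigcap_{i=1}^r \operatorname{conv}(A_i)\neq\emptyset$.
   Context: An ordered set $X=\{x_1,\dots,x_n\}\subset\mathbb{R}^d$ (ordered by the indices), in general position, is called order-type homogeneous if all of its $(d+1)$-element subsets, listed in the induced order, have the same orientation; i.e. for all $i_1<\dots<i_{d+1}$ the sign of the determinant of the $(d+1)\times(d+1)$ matrix with columns $(1,x_{i_1}),\dots,(1,x_{i_{d+1}})$ is the same nonzero sign. The alternating partition of an ordered set $X=\{x_1,\dots,x_n\}$ into $r$ parts is the partition $A_1,\dots,A_r$ given by $A_i=\{x_j : j\equiv i \pmod r\}$. -}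

module Defs where

open import Level using (0ℓ)
open import Algebra.Bundles using (CommutativeRing)
import Algebra.Properties.Semiring.Sum as SemiringSum
import Algebra.Properties.Semiring.Exp as SemiringExp
open import Data.Fin using (Fin; zero; suc; toℕ; punchIn)
import Data.Fin as Fin
open import Data.Nat using (ℕ; zero; suc; NonZero)
open import Data.Nat.DivMod using (_%_)
open import Data.Product using (Σ; ∃; _×_)
open import Data.Sum using (_⊎_)
open import Data.Vec.Functional using (Vector)
open import Function.Definitions using (Injective)
open import Relation.Binary.Core using (Rel)
open import Relation.Binary.Structures using (IsStrictTotalOrder)
import Relation.Binary.Construct.StrictToNonStrict as StrictToNonStrict
open import Relation.Binary.PropositionalEquality using (_≡_)
open import Relation.Nullary using (¬_)
open import Relation.Unary using (Pred; _∈_; Satisfiable)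

-- The real numbers, given by the axioms that characterise them up to
-- isomorphism: a Dedekind-complete totally ordered field.  Trichotomy and
-- suprema are those of classical mathematics.
record RealNumbers : Set₁ where
  field
    commutativeRing : CommutativeRing 0ℓ 0ℓ

  open CommutativeRing commutativeRing public

  infix 4 _<_

  field
    _<_                : Rel Carrier 0ℓ
    isStrictTotalOrder : IsStrictTotalOrder _≈_ _<_
    1≉0                : ¬ (1# ≈ 0#)
    inverse            : ∀ x → ¬ (x ≈ 0#) → ∃ λ y → x * y ≈ 1#
    +-monoʳ-<          : ∀ x {y z} → y < z → x + y < x + z
    *-pos              : ∀ {x y} → 0# < x → 0# < y → 0# < x * y

  -- x ≤ y  is  (x < y) ⊎ (x ≈ y)
  open StrictToNonStrict _≈_ _<_ public using (_≤_)

  UpperBound : Pred Carrier 0ℓ → Pred Carrier 0ℓ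
  UpperBound P b = ∀ {x} → x ∈ P → x ≤ b

  field
    supremum : (P : Pred Carrier 0ℓ) → Satisfiable P → Satisfiable (UpperBound P) →
               ∃ λ s → s ∈ UpperBound P × (∀ {b} → b ∈ UpperBound P → s ≤ b)

module _ (ℝ : RealNumbers) where

  open RealNumbers ℝ hiding (zero)
  open SemiringSum semiring using (sum)
  open SemiringExp semiring using (_^_)

  Point : ℕ → Set
  Point d = Vector Carrier d

  infix 4 _≋_
  _≋_ : ∀ {d} → Rel (Point d) 0ℓ
  x ≋ y = ∀ k → x k ≈ y k

  -- Laplace expansion along the first row; M a b is the entry in row a and
  -- column b.
  det : ∀ {m} → (Fin m → Fin m → Carrier) → Carrier
  det {zero}  M = 1#
  det {suc m} M = sum λ j →
    (- 1#) ^ toℕ j * (M zero j * det λ a b → M (suc a) (punchIn j b))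

  -- The matrix with columns (1 , y₀), …, (1 , y_d).
  homogenize : ∀ {d} → (Fin (suc d) → Point d) → Fin (suc d) → Fin (suc d) → Carrier
  homogenize y zero    b = 1#
  homogenize y (suc a) b = y b a

  StrictlyIncreasing : ∀ {m n} → (Fin m → Fin n) → Set
  StrictlyIncreasing s = ∀ {a b} → a Fin.< b → s a Fin.< s b

  -- General position of the (d+1)-tuples is contained in the determinants
  -- being nonzero.
  record OrderTypeHomogeneous {n d} (X : Fin n → Point d) : Set where
    field
      distinct        : Injective _≡_ _≋_ X
      sameOrientation :
          ((s : Fin (suc d) → Fin n) → StrictlyIncreasing s →
             0# < det (homogenize λ a → X (s a)))
        ⊎ ((s : Fin (suc d) → Fin n) → StrictlyIncreasing s →
             det (homogenize λ a → X (s a)) < 0#)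

  -- Points and parts are both numbered from 0 instead of 1, which leaves the
  -- congruence between the two indices unchanged.
  alternatingPart : ∀ {n d} → (Fin n → Point d) →
                    (r : ℕ) .{{_ : NonZero r}} → Fin r → Pred (Point d) 0ℓ
  alternatingPart X r i p = ∃ λ j → (toℕ j % r ≡ toℕ i % r) × p ≋ X j

  conv : ∀ {d} → Pred (Point d) 0ℓ → Pred (Point d) 0ℓ
  conv {d} A p =
    Σ ℕ λ m → Σ (Vector Carrier m) λ w → Σ (Fin m → Point d) λ y →
      (∀ k → 0# ≤ w k) × sum w ≈ 1# × (∀ k → y k ∈ A) ×
      p ≋ (λ c → sum λ k → w k * y k c)

{-# OPTIONS --safe #-}

-- By Farkas' lemma a common point of the hulls exists unless there are affine
-- functionals f₁, …, f_r, with fᵢ ≥ 0 on Aᵢ, whose sum is a negative constant.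
-- By Carathéodory's theorem at most d + 1 of them already have a nonnegative
-- combination equal to this constant, so every point of X is in the negative
-- half-space of one of these.  A half-space {fᵢ < 0} misses Aᵢ and hence
-- contains no r consecutive points.  It contains at most ⌊d/2⌋ + 1 runs of
-- consecutive points: otherwise the sign of fᵢ would alternate along d + 2
-- points, and their Cramer dependency, whose coefficients also alternate in
-- sign by homogeneity, would evaluate under fᵢ to a sum of terms of one sign.
-- Thus n ≤ (d + 1)(⌊d/2⌋ + 1)(r − 1), contrary to assumption.
module Submission where

open import Defs
import Algebra.Properties.CommutativeMonoid.Sum as CommutativeMonoidSum
import Algebra.Properties.Monoid.Mult as MonoidMult
import Algebra.Properties.Ring as RingProperties
import Algebra.Properties.Semiring.Exp as SemiringExp
import Algebra.Properties.Semiring.Mult as SemiringMult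
import Algebra.Properties.Semiring.Sum as SemiringSum
import Algebra.Solver.Ring
import Algebra.Solver.Ring.AlmostCommutativeRing as ACR
open import Algebra.Bundles using (CommutativeRing)
import Data.Fin as Fin
open import Data.Fin using (Fin; zero; suc; toℕ; punchIn; pinch; combine; remQuot; _↑ˡ_; _↑ʳ_; inject≤)
import Data.Fin.Properties as Fin
import Data.Integer as ℤ
import Data.Integer.Properties as ℤ
open import Data.Maybe using (Maybe; just; nothing)
import Data.Nat as ℕ
open import Data.Nat using (ℕ; zero; suc; NonZero; ⌊_/2⌋)
open import Data.Nat.DivMod using (_%_; _mod_; m%n<n; m<n⇒m%n≡m; m%n%n≡m%n; [m+kn]%n≡m%n)
import Data.Nat.Properties as ℕ
open import Data.Product using (Σ; ∃; _×_; _,_; proj₁; proj₂; uncurry)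
import Data.Sign as Sign
open import Data.Sum using (_⊎_; inj₁; inj₂)
open import Data.Unit using (⊤; tt)
open import Data.Vec.Functional using (Vector; _∷_; insertAt)
open import Data.Vec.Functional.Properties using (insertAt-lookup; insertAt-punchIn)
open import Function using (_∘_; id)
open import Level using (0ℓ)
open import Relation.Binary.Definitions using (tri<; tri≈; tri>)
open import Relation.Binary.PropositionalEquality as ≡ using (_≡_)
import Relation.Binary.Reasoning.Setoid as SetoidReasoning
open import Relation.Binary.Structures using (IsStrictTotalOrder)
open import Relation.Nullary using (¬_; Dec; yes; no; contradiction; ¬?)
open import Relation.Nullary.Decidable using (decidable-stable)
open import Relation.Unary using (Pred; Decidable; Satisfiable; ⋂; ∁)

-- Ring solver with integer coefficients.

-- With coefficients in R itself the ring solver could not see that 1 − 1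
-- vanishes; with integer coefficients it can.
module IntegerSolver (R : CommutativeRing 0ℓ 0ℓ) where
  open CommutativeRing R
  open RingProperties ring
  open SemiringMult semiring using (×1-homo-*)
  open MonoidMult +-monoid renaming (_×_ to _·_)
  open SetoidReasoning setoid

  ⟦_⟧ : ℤ.ℤ → Carrier
  ⟦ ℤ.+ n ⟧      = n · 1#
  ⟦ ℤ.-[1+ n ] ⟧ = - (suc n · 1#)

  ⟦⟧-⊖ : ∀ m n → ⟦ m ℤ.⊖ n ⟧ ≈ m · 1# - n · 1#
  ⟦⟧-⊖ zero    zero    = sym (-‿inverseʳ 0#)
  ⟦⟧-⊖ zero    (suc n) = sym (+-identityˡ _)
  ⟦⟧-⊖ (suc m) zero    = sym (trans (+-congˡ -0#≈0#) (+-identityʳ _))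
  ⟦⟧-⊖ (suc m) (suc n) = begin
    ⟦ suc m ℤ.⊖ suc n ⟧                 ≡⟨ ≡.cong ⟦_⟧ (ℤ.[1+m]⊖[1+n]≡m⊖n m n) ⟩
    ⟦ m ℤ.⊖ n ⟧                         ≈⟨ ⟦⟧-⊖ m n ⟩
    m · 1# - n · 1#                     ≈⟨ +-congʳ (+-identityʳ _) ⟨
    m · 1# + 0# - n · 1#                ≈⟨ +-congʳ (+-congˡ (-‿inverseʳ 1#)) ⟨
    m · 1# + (1# - 1#) - n · 1#         ≈⟨ +-congʳ (+-assoc _ _ _) ⟨
    m · 1# + 1# - 1# - n · 1#           ≈⟨ +-assoc _ _ _ ⟩
    m · 1# + 1# + (- 1# - n · 1#)       ≈⟨ +-cong (+-comm _ _) (-‿+-comm _ _) ⟩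
    suc m · 1# - suc n · 1#             ∎

  ⟦⟧-- : ∀ i → ⟦ ℤ.- i ⟧ ≈ - ⟦ i ⟧
  ⟦⟧-- (ℤ.+ zero)    = sym -0#≈0#
  ⟦⟧-- (ℤ.+ suc n)   = refl
  ⟦⟧-- ℤ.-[1+ n ]    = sym (-‿involutive _)

  ⟦⟧-+ : ∀ i j → ⟦ i ℤ.+ j ⟧ ≈ ⟦ i ⟧ + ⟦ j ⟧
  ⟦⟧-+ (ℤ.+ m)    (ℤ.+ n)    = ×-homo-+ 1# m n
  ⟦⟧-+ (ℤ.+ m)    ℤ.-[1+ n ] = ⟦⟧-⊖ m (suc n)
  ⟦⟧-+ ℤ.-[1+ m ] (ℤ.+ n)    = trans (⟦⟧-⊖ n (suc m)) (+-comm _ _)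
  ⟦⟧-+ ℤ.-[1+ m ] ℤ.-[1+ n ] = begin
    - (suc (suc (m ℕ.+ n)) · 1#)        ≡⟨ ≡.cong (λ k → - (k · 1#)) (≡.cong suc (≡.sym (ℕ.+-suc m n))) ⟩
    - ((suc m ℕ.+ suc n) · 1#)          ≈⟨ -‿cong (×-homo-+ 1# (suc m) (suc n)) ⟩
    - (suc m · 1# + suc n · 1#)         ≈⟨ -‿+-comm _ _ ⟨
    - (suc m · 1#) - suc n · 1#         ∎

  ⟦⟧-* : ∀ i j → ⟦ i ℤ.* j ⟧ ≈ ⟦ i ⟧ * ⟦ j ⟧
  ⟦⟧-* (ℤ.+ m) (ℤ.+ n) = trans (reflexive (≡.cong ⟦_⟧ (ℤ.+◃n≡+n (m ℕ.* n)))) (×1-homo-* m n)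
  ⟦⟧-* (ℤ.+ m) ℤ.-[1+ n ] = begin
    ⟦ Sign.- ℤ.◃ m ℕ.* suc n ⟧  ≡⟨ ≡.cong ⟦_⟧ (ℤ.-◃n≡-n (m ℕ.* suc n)) ⟩
    ⟦ ℤ.- ℤ.+ (m ℕ.* suc n) ⟧   ≈⟨ ⟦⟧-- (ℤ.+ (m ℕ.* suc n)) ⟩
    - ((m ℕ.* suc n) · 1#)      ≈⟨ -‿cong (×1-homo-* m (suc n)) ⟩
    - (m · 1# * suc n · 1#)     ≈⟨ -‿distribʳ-* _ _ ⟩
    m · 1# * - (suc n · 1#)     ∎
  ⟦⟧-* ℤ.-[1+ m ] (ℤ.+ n) = begin
    ⟦ Sign.- ℤ.◃ suc m ℕ.* n ⟧  ≡⟨ ≡.cong ⟦_⟧ (ℤ.-◃n≡-n (suc m ℕ.* n)) ⟩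
    ⟦ ℤ.- ℤ.+ (suc m ℕ.* n) ⟧   ≈⟨ ⟦⟧-- (ℤ.+ (suc m ℕ.* n)) ⟩
    - ((suc m ℕ.* n) · 1#)      ≈⟨ -‿cong (×1-homo-* (suc m) n) ⟩
    - (suc m · 1# * n · 1#)     ≈⟨ -‿distribˡ-* _ _ ⟩
    - (suc m · 1#) * n · 1#     ∎
  ⟦⟧-* ℤ.-[1+ m ] ℤ.-[1+ n ] = begin
    (suc m ℕ.* suc n) · 1#                ≈⟨ ×1-homo-* (suc m) (suc n) ⟩
    suc m · 1# * suc n · 1#               ≈⟨ -‿involutive _ ⟨
    - - (suc m · 1# * suc n · 1#)         ≈⟨ -‿cong (-‿distribʳ-* _ _) ⟩
    - (suc m · 1# * - (suc n · 1#))       ≈⟨ -‿distribˡ-* _ _ ⟩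
    - (suc m · 1#) * - (suc n · 1#)       ∎

  ℤ⟶R : ℤ.+-*-rawRing ACR.-Raw-AlmostCommutative⟶ ACR.fromCommutativeRing R
  ℤ⟶R = record
    { ⟦_⟧    = ⟦_⟧
    ; +-homo = ⟦⟧-+
    ; *-homo = ⟦⟧-*
    ; -‿homo = ⟦⟧--
    ; 0-homo = refl
    ; 1-homo = +-identityʳ 1#
    }

  ⟦⟧-≟ : ∀ i j → Maybe (⟦ i ⟧ ≈ ⟦ j ⟧)
  ⟦⟧-≟ i j with i ℤ.≟ j
  ... | yes ≡.refl = just refl
  ... | no _       = nothing

  open Algebra.Solver.Ring ℤ.+-*-rawRing (ACR.fromCommutativeRing R) ℤ⟶R ⟦⟧-≟ public
    using (solve; _:+_; _:*_; :-_; _:-_; _:=_)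

-- Arithmetic of inequalities in an ordered field.

module OrderedField (ℝ : RealNumbers) where
  open RealNumbers ℝ hiding (zero)
  open IsStrictTotalOrder isStrictTotalOrder public
    using (compare; _≟_; _<?_; <-respʳ-≈; <-respˡ-≈)
    renaming (irrefl to <-irrefl; trans to <-trans; asym to <-asym)
  open RingProperties ring
  open IntegerSolver commutativeRing

  ≤-respˡ : ∀ {x y z} → x ≈ y → x ≤ z → y ≤ z
  ≤-respˡ x≈y (inj₁ x<z) = inj₁ (<-respˡ-≈ x≈y x<z)
  ≤-respˡ x≈y (inj₂ x≈z) = inj₂ (trans (sym x≈y) x≈z)

  ≤-respʳ : ∀ {x y z} → y ≈ z → x ≤ y → x ≤ z
  ≤-respʳ y≈z (inj₁ x<y) = inj₁ (<-respʳ-≈ y≈z x<y)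
  ≤-respʳ y≈z (inj₂ x≈y) = inj₂ (trans x≈y y≈z)

  ≮⇒≥ : ∀ {x y} → ¬ (x < y) → y ≤ x
  ≮⇒≥ {x} {y} x≮y with compare x y
  ... | tri< x<y _ _ = contradiction x<y x≮y
  ... | tri≈ _ x≈y _ = inj₂ (sym x≈y)
  ... | tri> _ _ y<x = inj₁ y<x

  ≤⇒≯ : ∀ {x y} → x ≤ y → ¬ (y < x)
  ≤⇒≯ (inj₁ x<y) y<x = <-asym x<y y<x
  ≤⇒≯ (inj₂ x≈y) y<x = <-irrefl (sym x≈y) y<x

  neg-pos : ∀ {x} → x < 0# → 0# < - x
  neg-pos {x} x<0 = <-respˡ-≈ (-‿inverseˡ x) (<-respʳ-≈ (+-identityʳ _) (+-monoʳ-< (- x) x<0))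

  pos-neg : ∀ {x} → 0# < x → - x < 0#
  pos-neg {x} 0<x = <-respˡ-≈ (+-identityʳ _) (<-respʳ-≈ (-‿inverseˡ x) (+-monoʳ-< (- x) 0<x))

  neg-pos⁻¹ : ∀ {x} → 0# < - x → x < 0#
  neg-pos⁻¹ {x} 0<-x = <-respˡ-≈ (-‿involutive x) (pos-neg 0<-x)

  nonpos-neg : ∀ {x} → x ≤ 0# → 0# ≤ - x
  nonpos-neg (inj₁ x<0) = inj₁ (neg-pos x<0)
  nonpos-neg (inj₂ x≈0) = inj₂ (sym (trans (-‿cong x≈0) -0#≈0#))

  pos+nonneg : ∀ {x y} → 0# < x → 0# ≤ y → 0# < x + y
  pos+nonneg 0<x (inj₁ 0<y) = <-trans 0<x (<-respˡ-≈ (+-identityʳ _) (+-monoʳ-< _ 0<y))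
  pos+nonneg 0<x (inj₂ 0≈y) = <-respʳ-≈ (trans (sym (+-identityʳ _)) (+-congˡ 0≈y)) 0<x

  +-nonneg : ∀ {x y} → 0# ≤ x → 0# ≤ y → 0# ≤ x + y
  +-nonneg (inj₁ 0<x) 0≤y = inj₁ (pos+nonneg 0<x 0≤y)
  +-nonneg (inj₂ 0≈x) 0≤y = ≤-respʳ (trans (sym (+-identityˡ _)) (+-congʳ 0≈x)) 0≤y

  *-nonneg : ∀ {x y} → 0# ≤ x → 0# ≤ y → 0# ≤ x * y
  *-nonneg (inj₁ 0<x) (inj₁ 0<y) = inj₁ (*-pos 0<x 0<y)
  *-nonneg (inj₁ 0<x) (inj₂ 0≈y) = inj₂ (sym (trans (*-congˡ (sym 0≈y)) (zeroʳ _)))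
  *-nonneg (inj₂ 0≈x) _          = inj₂ (sym (trans (*-congʳ (sym 0≈x)) (zeroˡ _)))

  square-pos : ∀ {x} → ¬ (x ≈ 0#) → 0# < x * x
  square-pos {x} x≉0 with compare x 0#
  ... | tri< x<0 _ _ = <-respʳ-≈ (solve 1 (λ x → (:- x) :* (:- x) := x :* x) refl x)
                         (*-pos (neg-pos x<0) (neg-pos x<0))
  ... | tri≈ _ x≈0 _ = contradiction x≈0 x≉0
  ... | tri> _ _ 0<x = *-pos 0<x 0<x

  0<1 : 0# < 1#
  0<1 = <-respʳ-≈ (*-identityˡ 1#) (square-pos 1≉0)

  pos⇒≉0 : ∀ {x} → 0# < x → ¬ (x ≈ 0#)
  pos⇒≉0 0<x x≈0 = <-irrefl (sym x≈0) 0<x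

  inverse-pos : ∀ {x} → 0# < x → ∃ λ y → 0# < y × x * y ≈ 1#
  inverse-pos {x} 0<x with inverse x (pos⇒≉0 0<x)
  ... | y , xy≈1 with compare y 0#
  ...   | tri> _ _ 0<y = y , 0<y , xy≈1
  ...   | tri≈ _ y≈0 _ = contradiction (trans (sym xy≈1) (trans (*-congˡ y≈0) (zeroʳ x))) 1≉0
  ...   | tri< y<0 _ _ = contradiction 0<1 (<-asym (neg-pos⁻¹ (<-respʳ-≈ x*-y≈-1 (*-pos 0<x (neg-pos y<0)))))
    where
    x*-y≈-1 : x * - y ≈ - 1#
    x*-y≈-1 = trans (sym (-‿distribʳ-* x y)) (-‿cong xy≈1)

  -- The characteristic is not two; this turns det M = - det M into the vanishing of a determinant
  -- with two equal rows.
  x+x≈0⇒x≈0 : ∀ {x} → x + x ≈ 0# → x ≈ 0#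
  x+x≈0⇒x≈0 {x} x+x≈0 with compare x 0#
  ... | tri< x<0 _ _ = contradiction (trans (-‿+-comm x x) (trans (-‿cong x+x≈0) -0#≈0#))
                         (pos⇒≉0 (pos+nonneg (neg-pos x<0) (inj₁ (neg-pos x<0))))
  ... | tri≈ _ x≈0 _ = x≈0
  ... | tri> _ _ 0<x = contradiction x+x≈0 (pos⇒≉0 (pos+nonneg 0<x (inj₁ 0<x)))

-- Finite sums and dot products.

module LinearAlgebra (ℝ : RealNumbers) where
  open RealNumbers ℝ hiding (zero)
  open OrderedField ℝ
  open RingProperties ring
  open SemiringSum semiring
  open IntegerSolver commutativeRing
  open SetoidReasoning setoid

  sum-zero : ∀ {n} {x : Vector Carrier n} → (∀ i → x i ≈ 0#) → sum x ≈ 0#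
  sum-zero {n} x≈0 = trans (sum-cong-≋ x≈0) (sum-replicate-zero n)

  sum-nonneg : ∀ {n} {x : Vector Carrier n} → (∀ i → 0# ≤ x i) → 0# ≤ sum x
  sum-nonneg {zero}  0≤x = inj₂ refl
  sum-nonneg {suc n} 0≤x = +-nonneg (0≤x zero) (sum-nonneg (0≤x ∘ suc))

  sum-pos : ∀ {n} {x : Vector Carrier n} → (∀ i → 0# ≤ x i) → ∀ k → 0# < x k → 0# < sum x
  sum-pos {suc n} {x} 0≤x k 0<xk =
    <-respʳ-≈ (sym (sum-remove {i = k} x)) (pos+nonneg 0<xk (sum-nonneg (0≤x ∘ punchIn k)))

  sum-neg : ∀ {n} (x : Vector Carrier n) → sum (λ i → - x i) ≈ - sum x
  sum-neg {zero}  x = sym -0#≈0#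
  sum-neg {suc n} x = trans (+-congˡ (sum-neg (x ∘ suc))) (-‿+-comm _ _)

  sum-+* : ∀ {n} (x y : Vector Carrier n) c → sum (λ i → x i + c * y i) ≈ sum x + c * sum y
  sum-+* x y c = trans (∑-distrib-+ x (λ i → c * y i)) (+-congˡ (sym (*-distribˡ-sum c y)))

  dot : ∀ {n} → Vector Carrier n → Vector Carrier n → Carrier
  dot x y = sum λ i → x i * y i

  dot-+*ˡ : ∀ {n} (x x′ y : Vector Carrier n) c →
            dot (λ i → x i + c * x′ i) y ≈ dot x y + c * dot x′ y
  dot-+*ˡ x x′ y c = trans
    (sum-cong-≋ λ i → solve 4 (λ x x′ y c → (x :+ c :* x′) :* y := x :* y :+ c :* (x′ :* y))
                              refl (x i) (x′ i) (y i) c)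
    (sum-+* (λ i → x i * y i) (λ i → x′ i * y i) c)

  dot-+*ʳ : ∀ {n} (x y y′ : Vector Carrier n) c →
            dot x (λ i → y i + c * y′ i) ≈ dot x y + c * dot x y′
  dot-+*ʳ x y y′ c = trans
    (sum-cong-≋ λ i → solve 4 (λ x y y′ c → x :* (y :+ c :* y′) := x :* y :+ c :* (x :* y′))
                              refl (x i) (y i) (y′ i) c)
    (sum-+* (λ i → x i * y i) (λ i → x i * y′ i) c)

  dot-neg : ∀ {n} (x : Vector Carrier n) → dot x (λ i → - x i) ≈ - sum (λ i → x i * x i)
  dot-neg x = trans (sum-cong-≋ λ i → sym (-‿distribʳ-* (x i) (x i))) (sum-neg λ i → x i * x i)

  -- Finitely generated cones and Farkas' lemma.

  InCone : ∀ {D N} → (Fin N → Vector Carrier D) → Vector Carrier D → Set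
  InCone {D} {N} a b = Σ (Vector Carrier N) λ u → (∀ j → 0# ≤ u j) × (∀ k → b k ≈ sum λ j → u j * a j k)

  Separated : ∀ {D N} → (Fin N → Vector Carrier D) → Vector Carrier D → Set
  Separated {D} a b = Σ (Vector Carrier D) λ f → (∀ j → 0# ≤ dot (a j) f) × dot b f < 0#

  -- Induction on the number of generators. A functional `f` separating `b` from the later
  -- generators also does for all of them if it is nonnegative on the first. Otherwise everything is
  -- projected along `a zero` onto the kernel of `f` and induction is applied once more: a conic
  -- representation of the projected `b` lifts, and a separating functional pulls back.
  farkas : ∀ {D} N (a : Fin N → Vector Carrier D) (b : Vector Carrier D) →
           InCone a b ⊎ Separated a b
  farkas {D} zero a b with Fin.any? (λ k → ¬? (b k ≟ 0#))
  ... | no ∄k = inj₁ ((λ ()) , (λ ()) ,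
                      λ k → decidable-stable (b k ≟ 0#) λ bk≉0 → ∄k (k , bk≉0))
  -- The cone without generators is the origin. A nonzero `b` is separated from it by `- b`, whose
  -- value at `b` is minus a sum of squares.
  ... | yes (k , bk≉0) = inj₂ ((λ i → - b i) , (λ ()) , <-respˡ-≈ (sym (dot-neg b))
          (pos-neg (sum-pos square-nonneg k (square-pos bk≉0))))
    where
    square-nonneg : ∀ i → 0# ≤ b i * b i
    square-nonneg i with b i ≟ 0#
    ... | yes bi≈0 = inj₂ (sym (trans (*-congʳ bi≈0) (zeroˡ _)))
    ... | no  bi≉0 = inj₁ (square-pos bi≉0)
  farkas {D} (suc N) a b with farkas N (a ∘ suc) b
  ... | inj₁ (u , 0≤u , b≈) = inj₁ ((0# ∷ u) , (λ { zero → inj₂ refl ; (suc j) → 0≤u j }) , λ k →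
          trans (b≈ k) (sym (trans (+-congʳ (zeroˡ _)) (+-identityˡ _))))
  ... | inj₂ (f , 0≤af , bf<0) with dot (a zero) f <? 0#
  ...   | no af≮0 = inj₂ (f , (λ { zero → ≮⇒≥ af≮0 ; (suc j) → 0≤af j }) , bf<0)
  ...   | yes af<0 = result (farkas N (project ∘ a ∘ suc) (project b))
    where
    A = a zero
    α = dot A f
    β = proj₁ (inverse-pos (neg-pos af<0))
    0<β : 0# < β
    0<β = proj₁ (proj₂ (inverse-pos (neg-pos af<0)))
    -αβ≈1 : - α * β ≈ 1#
    -αβ≈1 = proj₂ (proj₂ (inverse-pos (neg-pos af<0)))

    -- The projection along a zero onto the kernel of f.
    project : Vector Carrier D → Vector Carrier D
    project v k = v k + (β * dot v f) * A k

    -- The adjoint of the projection. The functional on the right vanishes on `A`, so a separation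
    -- of the projected vectors becomes one of the original vectors, `A` included.
    dot-project : ∀ v g → dot (project v) g ≈ dot v (λ k → g k + (β * dot A g) * f k)
    dot-project v g = begin
      dot (project v) g                        ≈⟨ dot-+*ˡ v A g (β * dot v f) ⟩
      dot v g + (β * dot v f) * dot A g
        ≈⟨ +-congˡ (solve 3 (λ x y z → (x :* y) :* z := (x :* z) :* y) refl β (dot v f) (dot A g)) ⟩
      dot v g + (β * dot A g) * dot v f        ≈⟨ dot-+*ʳ v g f (β * dot A g) ⟨
      dot v (λ k → g k + (β * dot A g) * f k)  ∎

    result : InCone (project ∘ a ∘ suc) (project b) ⊎ Separated (project ∘ a ∘ suc) (project b) →
             InCone a b ⊎ Separated a b
    result (inj₁ (u , 0≤u , b≈)) = inj₁ ((u₀ ∷ u) , (λ { zero → 0≤u₀ ; (suc j) → 0≤u j }) , b≈′)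
      where
      φ = λ j → dot (a (suc j)) f
      s = dot u φ
      -- Undoing the projections on both sides of `b≈` leaves `A` with this coefficient. It is
      -- nonnegative since `s` is and `f` is negative on `b`.
      u₀ = β * (s + - dot b f)

      0≤u₀ : 0# ≤ u₀
      0≤u₀ = *-nonneg (inj₁ 0<β) (+-nonneg (sum-nonneg λ j → *-nonneg (0≤u j) (0≤af j)) (inj₁ (neg-pos bf<0)))

      b≈′ : ∀ k → b k ≈ u₀ * A k + sum (λ j → u j * a (suc j) k)
      b≈′ k = begin
        b k
          ≈⟨ solve 2 (λ x y → x := (x :+ y) :- y) refl (b k) ((β * dot b f) * A k) ⟩
        project b k - (β * dot b f) * A k
          ≈⟨ +-congʳ (b≈ k) ⟩
        sum (λ j → u j * project (a (suc j)) k) - (β * dot b f) * A k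
          ≈⟨ +-congʳ (sum-cong-≋ λ j →
               solve 5 (λ u x β φ A → u :* (x :+ (β :* φ) :* A) := u :* x :+ (β :* A) :* (u :* φ))
                       refl (u j) (a (suc j) k) β (φ j) (A k)) ⟩
        sum (λ j → u j * a (suc j) k + (β * A k) * (u j * φ j)) - (β * dot b f) * A k
          ≈⟨ +-congʳ (sum-+* (λ j → u j * a (suc j) k) (λ j → u j * φ j) (β * A k)) ⟩
        sum (λ j → u j * a (suc j) k) + (β * A k) * s - (β * dot b f) * A k
          ≈⟨ solve 5 (λ x β A s y → x :+ (β :* A) :* s :- (β :* y) :* A := (β :* (s :+ :- y)) :* A :+ x)
                     refl (sum (λ j → u j * a (suc j) k)) β (A k) s (dot b f) ⟩
        u₀ * A k + sum (λ j → u j * a (suc j) k) ∎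
    result (inj₂ (g , 0≤ag , bg<0)) = inj₂ (h , 0≤ah , <-respˡ-≈ (dot-project b g) bg<0)
      where
      h : Vector Carrier D
      h k = g k + (β * dot A g) * f k

      Ah≈0 : dot A h ≈ 0#
      Ah≈0 = begin
        dot A h                             ≈⟨ dot-+*ʳ A g f (β * dot A g) ⟩
        dot A g + (β * dot A g) * α
          ≈⟨ solve 3 (λ x β α → x :+ (β :* x) :* α := x :- (:- α :* β) :* x) refl (dot A g) β α ⟩
        dot A g - (- α * β) * dot A g       ≈⟨ +-congˡ (-‿cong (trans (*-congʳ -αβ≈1) (*-identityˡ _))) ⟩
        dot A g - dot A g                   ≈⟨ -‿inverseʳ _ ⟩
        0#                                  ∎

      0≤ah : ∀ j → 0# ≤ dot (a j) h
      0≤ah zero    = inj₂ (sym Ah≈0)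
      0≤ah (suc j) = ≤-respʳ (dot-project (a (suc j)) g) (0≤ag j)

  -- Linear dependencies and Carathéodory's theorem.

  -- Gaussian elimination, removing one equation and one unknown at a time. If the first row
  -- vanishes, the first unknown is set to zero; otherwise a nonzero entry of this row is the pivot
  -- and its column is cleared from the other rows.
  kernel : ∀ {D N} → D ℕ.< N → (M : Fin D → Vector Carrier N) →
           Σ (Vector Carrier N) λ μ → (∃ λ k → ¬ (μ k ≈ 0#)) × (∀ i → dot (M i) μ ≈ 0#)
  kernel {zero}  {suc N} _ M = (λ _ → 1#) , (zero , 1≉0) , λ ()
  kernel {suc D} {suc N} (ℕ.s≤s D<N) M with Fin.any? (λ k → ¬? (M zero k ≟ 0#))
  ... | no ∄k with kernel D<N (λ i k → M (suc i) (suc k))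
  ...   | μ , (k , μk≉0) , Mμ≈0 = (0# ∷ μ) , (suc k , μk≉0) , λ where
      zero    → sum-zero {x = λ k → M zero k * (0# ∷ μ) k} λ k → trans (*-congʳ (decidable-stable (M zero k ≟ 0#) λ Mk≉0 → ∄k (k , Mk≉0))) (zeroˡ _)
      (suc i) → trans (+-congʳ (zeroʳ _)) (trans (+-identityˡ _) (Mμ≈0 i))
  kernel {suc D} {suc N} (ℕ.s≤s D<N) M | yes (k , Mk≉0) = ν , nonzero , Mν≈0
    where
    y = proj₁ (inverse (M zero k) Mk≉0)
    R = λ j → M zero (punchIn k j)
    M′ : Fin D → Vector Carrier N
    M′ i j = M (suc i) (punchIn k j) + (- (M (suc i) k * y)) * R j

    μ = proj₁ (kernel D<N M′)
    s = dot R μ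
    -- The pivot coordinate is determined by the first equation, to which the other unknowns
    -- contribute `s`.
    ν = insertAt μ k (- (y * s))

    νk≈ : ν k ≈ - (y * s)
    νk≈ = reflexive (insertAt-lookup μ k _)
    νp≈ : ∀ j → ν (punchIn k j) ≈ μ j
    νp≈ j = reflexive (insertAt-punchIn μ k _ j)

    dot-ν : ∀ r → dot r ν ≈ r k * (- (y * s)) + dot (r ∘ punchIn k) μ
    dot-ν r = trans (sum-remove {i = k} (λ i → r i * ν i))
                (+-cong (*-congˡ νk≈) (sum-cong-≋ λ j → *-congˡ (νp≈ j)))

    nonzero : ∃ λ i → ¬ (ν i ≈ 0#)
    nonzero with proj₁ (proj₂ (kernel D<N M′))
    ... | j , μj≉0 = punchIn k j , λ νp≈0 → μj≉0 (trans (sym (νp≈ j)) νp≈0)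

    Mν≈0 : ∀ i → dot (M i) ν ≈ 0#
    Mν≈0 zero = begin
      dot (M zero) ν                 ≈⟨ dot-ν (M zero) ⟩
      M zero k * (- (y * s)) + s
        ≈⟨ solve 3 (λ m y s → m :* (:- (y :* s)) :+ s := s :- (m :* y) :* s) refl (M zero k) y s ⟩
      s - (M zero k * y) * s
        ≈⟨ +-congˡ (-‿cong (trans (*-congʳ (proj₂ (inverse (M zero k) Mk≉0))) (*-identityˡ s))) ⟩
      s - s                          ≈⟨ -‿inverseʳ s ⟩
      0#                             ∎
    Mν≈0 (suc i) = begin
      dot (M (suc i)) ν                                                 ≈⟨ dot-ν (M (suc i)) ⟩
      m * (- (y * s)) + dot (M (suc i) ∘ punchIn k) μ
        ≈⟨ solve 4 (λ m y s x → m :* (:- (y :* s)) :+ x := x :+ (:- (m :* y)) :* s) refl m y s _ ⟩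
      dot (M (suc i) ∘ punchIn k) μ + (- (m * y)) * s
        ≈⟨ dot-+*ˡ (M (suc i) ∘ punchIn k) R μ (- (m * y)) ⟨
      dot (M′ i) μ                                                      ≈⟨ proj₂ (proj₂ (kernel D<N M′)) i ⟩
      0#                                                                ∎
      where m = M (suc i) k

  -- Moving from u along μ until the first coordinate vanishes.
  ratio-test : ∀ {N} (u μ : Vector Carrier N) → (∀ j → 0# ≤ u j) →
               (∀ j → 0# ≤ μ j) ⊎
               ∃ λ t → 0# ≤ t × (∀ j → 0# ≤ u j + t * μ j) × ∃ λ k → u k + t * μ k ≈ 0#
  ratio-test {zero}  u μ 0≤u = inj₁ λ ()
  ratio-test {suc N} u μ 0≤u with ratio-test (u ∘ suc) (μ ∘ suc) (0≤u ∘ suc) | μ zero <? 0#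
  ... | inj₁ 0≤μ | no μ≮0 = inj₁ λ { zero → ≮⇒≥ μ≮0 ; (suc j) → 0≤μ j }
  ... | inj₂ (t , 0≤t , 0≤tail , k , vanish) | no μ≮0 =
    inj₂ (t , 0≤t , (λ { zero → +-nonneg (0≤u zero) (*-nonneg 0≤t (≮⇒≥ μ≮0)) ; (suc j) → 0≤tail j })
            , suc k , vanish)
  ... | tail | yes μ<0 = result tail
    where
    y = proj₁ (inverse-pos (neg-pos μ<0))
    0≤y : 0# ≤ y
    0≤y = inj₁ (proj₁ (proj₂ (inverse-pos (neg-pos μ<0))))
    -μy≈1 : - μ zero * y ≈ 1#
    -μy≈1 = proj₂ (proj₂ (inverse-pos (neg-pos μ<0)))
    -- The step length at which the head coordinate reaches zero.
    t₀ = u zero * y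

    vanish₀ : u zero + t₀ * μ zero ≈ 0#
    vanish₀ = begin
      u zero + (u zero * y) * μ zero
        ≈⟨ solve 3 (λ u y m → u :+ (u :* y) :* m := u :- u :* (:- m :* y)) refl (u zero) y (μ zero) ⟩
      u zero - u zero * (- μ zero * y)   ≈⟨ +-congˡ (-‿cong (trans (*-congˡ -μy≈1) (*-identityʳ _))) ⟩
      u zero - u zero                    ≈⟨ -‿inverseʳ _ ⟩
      0#                                 ∎

    0≤t₀ : 0# ≤ t₀
    0≤t₀ = *-nonneg (0≤u zero) 0≤y

    halt₀ : (∀ j → 0# ≤ u (suc j) + t₀ * μ (suc j)) →
            (∀ j → 0# ≤ μ j) ⊎
            ∃ λ t → 0# ≤ t × (∀ j → 0# ≤ u j + t * μ j) × ∃ λ k → u k + t * μ k ≈ 0#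
    halt₀ 0≤tail = inj₂ (t₀ , 0≤t₀ , (λ { zero → inj₂ (sym vanish₀) ; (suc j) → 0≤tail j }) , zero , vanish₀)

    result : _ → (∀ j → 0# ≤ μ j) ⊎
             ∃ λ t → 0# ≤ t × (∀ j → 0# ≤ u j + t * μ j) × ∃ λ k → u k + t * μ k ≈ 0#
    result (inj₁ 0≤μ) = halt₀ λ j → +-nonneg (0≤u (suc j)) (*-nonneg 0≤t₀ (0≤μ j))
    -- If the step `t` found for the tail makes the head negative, the head has vanished earlier, at
    -- `t₀ ≤ t`. Stopping there is safe for the tail: each of its coordinates is nonnegative at `t`,
    -- and a decreasing one is even larger at `t₀`.
    result (inj₂ (t , 0≤t , 0≤tail , k , vanish)) with (u zero + t * μ zero) <? 0#
    ... | no h≮0  = inj₂ (t , 0≤t , (λ { zero → ≮⇒≥ h≮0 ; (suc j) → 0≤tail j }) , suc k , vanish)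
    ... | yes h<0 = halt₀ 0≤tail₀
      where
      0≤t-t₀ : 0# ≤ t - t₀
      0≤t-t₀ = ≤-respʳ (begin
        - (u zero + t * μ zero) * y
          ≈⟨ solve 4 (λ u t m y → :- (u :+ t :* m) :* y := t :* (:- m :* y) :- u :* y) refl (u zero) t (μ zero) y ⟩
        t * (- μ zero * y) - u zero * y      ≈⟨ +-congʳ (trans (*-congˡ -μy≈1) (*-identityʳ t)) ⟩
        t - t₀                               ∎)
        (*-nonneg (inj₁ (neg-pos h<0)) 0≤y)

      0≤tail₀ : ∀ j → 0# ≤ u (suc j) + t₀ * μ (suc j)
      0≤tail₀ j with μ (suc j) <? 0#
      ... | no  μ≮0 = +-nonneg (0≤u (suc j)) (*-nonneg 0≤t₀ (≮⇒≥ μ≮0))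
      ... | yes μ<0 = ≤-respʳ
        (solve 4 (λ u t t₀ m → (u :+ t :* m) :+ (t :- t₀) :* (:- m) := u :+ t₀ :* m) refl (u (suc j)) t t₀ (μ (suc j)))
        (+-nonneg (0≤tail j) (*-nonneg 0≤t-t₀ (inj₁ (neg-pos μ<0))))

  -- More than `D` generators are linearly dependent. Moving the weights along a dependency leaves
  -- the combination unchanged; at the first moment when a weight vanishes its generator is dropped,
  -- and induction on `N` finishes.
  carathéodory : ∀ {D} N (a : Fin N → Vector Carrier D) b → InCone a b →
                 ∃ λ m → m ℕ.≤ D × Σ (Fin m → Fin N) λ s → InCone (a ∘ s) b
  carathéodory {D} N a b cone with N ℕ.≤? D
  ... | yes N≤D = N , N≤D , (λ j → j) , cone
  carathéodory {D} zero    a b cone | no N≰D = contradiction ℕ.z≤n N≰D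
  carathéodory {D} (suc N) a b (u , 0≤u , b≈) | no N≰D = result (carathéodory N (a ∘ punchIn k) b smaller)
    where
    dependency : Σ (Vector Carrier (suc N)) λ μ → (∃ λ k → μ k < 0#) × (∀ i → sum (λ j → μ j * a j i) ≈ 0#)
    dependency with kernel (ℕ.≰⇒> N≰D) (λ i j → a j i)
    ... | μ , (k , μk≉0) , aμ≈0 with compare (μ k) 0#
    ...   | tri< μk<0 _ _ = μ , (k , μk<0) , λ i → trans (sum-cong-≋ λ j → *-comm (μ j) (a j i)) (aμ≈0 i)
    ...   | tri≈ _ μk≈0 _ = contradiction μk≈0 μk≉0
    -- The sign of the dependency is chosen so that some coefficient is negative, which forces
    -- `ratio-test` to halt.
    ...   | tri> _ _ 0<μk = (λ j → - μ j) , (k , pos-neg 0<μk) , λ i → begin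
      sum (λ j → - μ j * a j i)      ≈⟨ sum-cong-≋ (λ j → solve 2 (λ x y → :- x :* y := :- (y :* x)) refl (μ j) (a j i)) ⟩
      sum (λ j → - (a j i * μ j))    ≈⟨ sum-neg (λ j → a j i * μ j) ⟩
      - sum (λ j → a j i * μ j)      ≈⟨ -‿cong (aμ≈0 i) ⟩
      - 0#                           ≈⟨ -0#≈0# ⟩
      0#                             ∎

    μ = proj₁ dependency

    halt : ∃ λ t → 0# ≤ t × (∀ j → 0# ≤ u j + t * μ j) × ∃ λ k → u k + t * μ k ≈ 0#
    halt with ratio-test u μ 0≤u
    ... | inj₁ 0≤μ = contradiction (proj₂ (proj₁ (proj₂ dependency))) (≤⇒≯ (0≤μ _))
    ... | inj₂ p   = p

    t = proj₁ halt
    k = proj₁ (proj₂ (proj₂ (proj₂ halt)))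
    vanish : u k + t * μ k ≈ 0#
    vanish = proj₂ (proj₂ (proj₂ (proj₂ halt)))

    smaller : InCone (a ∘ punchIn k) b
    smaller = (λ j → u (punchIn k j) + t * μ (punchIn k j))
            , (λ j → proj₁ (proj₂ (proj₂ halt)) (punchIn k j)) , λ i → begin
      b i                                                     ≈⟨ b≈ i ⟩
      sum (λ j → u j * a j i)                                 ≈⟨ +-identityʳ _ ⟨
      sum (λ j → u j * a j i) + 0#                            ≈⟨ +-congˡ (trans (*-congˡ (proj₂ (proj₂ dependency) i)) (zeroʳ t)) ⟨
      sum (λ j → u j * a j i) + t * sum (λ j → μ j * a j i)   ≈⟨ dot-+*ˡ u μ (λ j → a j i) t ⟨
      sum (λ j → (u j + t * μ j) * a j i)                     ≈⟨ sum-remove {i = k} (λ j → (u j + t * μ j) * a j i) ⟩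
      (u k + t * μ k) * a k i + _                             ≈⟨ +-congʳ (trans (*-congʳ vanish) (zeroˡ _)) ⟩
      0# + _                                                  ≈⟨ +-identityˡ _ ⟩
      sum (λ j → (u (punchIn k j) + t * μ (punchIn k j)) * a (punchIn k j) i) ∎

    result : (∃ λ m → m ℕ.≤ D × Σ (Fin m → Fin N) λ s → InCone (a ∘ punchIn k ∘ s) b) →
             ∃ λ m → m ℕ.≤ D × Σ (Fin m → Fin (suc N)) λ s → InCone (a ∘ s) b
    result (m , m≤D , s , c) = m , m≤D , punchIn k ∘ s , c

-- Runs of consecutive indices and alternating subsequences.

module Combinatorics where
  open import Data.Nat using (_+_; _*_; _≤_; _<_; z≤n; s≤s)
  open import Data.Nat.Properties
  open ≡ using (refl; cong)
  open CommutativeMonoidSum +-0-commutativeMonoid using (sum; ∑-distrib-+)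

  Increasing : ∀ {m n} → (Fin m → Fin n) → Set
  Increasing s = ∀ {a b} → a Fin.< b → s a Fin.< s b

  Alternating : ∀ {m} {A : Set} → Pred A 0ℓ → Pred A 0ℓ → Vector A m → Set
  Alternating {zero}  P Q s = ⊤
  Alternating {suc m} P Q s = P (s zero) × Alternating Q P (s ∘ suc)

  indicator : ∀ {A : Set} → Dec A → ℕ
  indicator (yes _) = 1
  indicator (no _)  = 0

  count : ∀ {n} {P : Pred (Fin n) 0ℓ} → Decidable P → ℕ
  count {zero}  P? = 0
  count {suc n} P? = indicator (P? zero) + count (P? ∘ suc)

  AlternatingSubsequence : ∀ {n} → ℕ → Pred (Fin n) 0ℓ → Pred (Fin n) 0ℓ → Set
  AlternatingSubsequence {n} m P Q = Σ (Fin m → Fin n) λ s → Increasing s × Alternating P Q s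

  empty : ∀ {n} (P Q : Pred (Fin n) 0ℓ) → AlternatingSubsequence 0 P Q
  empty P Q = (λ ()) , (λ { {()} }) , tt

  alternating-map : ∀ {m} {A B : Set} {P Q : Pred A 0ℓ} {P′ Q′ : Pred B 0ℓ} (f : A → B) →
                    (∀ {x} → P x → P′ (f x)) → (∀ {x} → Q x → Q′ (f x)) →
                    (s : Vector A m) → Alternating P Q s → Alternating P′ Q′ (f ∘ s)
  alternating-map {zero}  f g h s _        = tt
  alternating-map {suc m} f g h s (p , ps) = g p , alternating-map f h g (s ∘ suc) ps

  skip : ∀ {m n} {P Q : Pred (Fin (suc n)) 0ℓ} →
         AlternatingSubsequence m (P ∘ suc) (Q ∘ suc) → AlternatingSubsequence m P Q
  skip (s , inc , alt) = suc ∘ s , (λ a<b → s≤s (inc a<b)) , alternating-map suc id id s alt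

  keep : ∀ {m n} {P Q : Pred (Fin (suc n)) 0ℓ} → P zero →
         AlternatingSubsequence m (Q ∘ suc) (P ∘ suc) → AlternatingSubsequence (suc m) P Q
  keep {m} {n} p (s , inc , alt) = s′ , inc′ , p , alternating-map suc id id s alt
    where
    s′ : Fin (suc m) → Fin (suc n)
    s′ = zero ∷ suc ∘ s
    inc′ : Increasing s′
    inc′ {zero}  {suc b} _         = s≤s z≤n
    inc′ {suc a} {suc b} (s≤s a<b) = s≤s (inc a<b)

  -- A residue class encoded by an offset `e` and a period `r`: dropping the first index lowers the
  -- offset by one, or wraps it around at zero, so the recursion below can carry it along.
  FailsEvery : ∀ {n} → ℕ → ℕ → Pred (Fin n) 0ℓ → Set
  FailsEvery r e P = ∀ j t → toℕ j ≡ e + t * r → ¬ P j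

  fails-tail : ∀ {n r e} {P : Pred (Fin (suc n)) 0ℓ} →
               FailsEvery r (suc e) P → FailsEvery r e (P ∘ suc)
  fails-tail F j t eq = F (suc j) t (cong suc eq)

  fails-wrap : ∀ {n r} {P : Pred (Fin (suc n)) 0ℓ} →
               FailsEvery (suc r) 0 P → FailsEvery (suc r) r (P ∘ suc)
  fails-wrap F j t eq = F (suc j) (suc t) (cong suc eq)

  -- In run-out the points before the current position end with a run of P, of
  -- which at most e more points can follow.
  mutual
    -- Since P fails at least once among any `suc r` consecutive indices, a run of P has at most `r`
    -- elements. More than ⌊m/2⌋ r elements therefore form at least ⌊m/2⌋ + 1 runs, and the first
    -- elements of the runs and of the gaps between them alternate at least `m` times. The recursion
    -- makes this greedy choice.
    alternation : ∀ {n} m r e {P : Pred (Fin n) 0ℓ} (P? : Decidable P) →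
                  FailsEvery (suc r) e P → e ≤ r → ⌊ m /2⌋ * r < count P? →
                  AlternatingSubsequence m P (∁ P)
    alternation zero r e {P} P? F e≤r lt = empty P (∁ P)
    alternation {suc n} (suc m) r e P? F e≤r lt with P? zero
    alternation {suc n} (suc m) r zero    P? F e≤r lt | no ¬p =
      skip (alternation (suc m) r r (P? ∘ suc) (fails-wrap F) ≤-refl lt)
    alternation {suc n} (suc m) r (suc e) P? F e≤r lt | no ¬p =
      skip (alternation (suc m) r e (P? ∘ suc) (fails-tail F) (<⇒≤ e≤r) lt)
    alternation {suc n} (suc m) r zero    P? F e≤r lt | yes p = contradiction p (F zero 0 refl)
    alternation {suc n} (suc zero) r (suc e) {P} P? F e≤r lt | yes p =
      keep {P = P} {∁ P} p (empty (∁ P ∘ suc) (P ∘ suc))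
    alternation {suc n} (suc (suc m)) r (suc e) P? F e≤r (s≤s lt) | yes p =
      -- A run begins here. One share of `r` is set aside for it, which suffices because after the
      -- current element at most `e < r` more can follow.
      keep p (run-out m r e (P? ∘ suc) (fails-tail F) (<⇒≤ e≤r) (begin-strict
        ⌊ m /2⌋ * r + e   ≡⟨ +-comm (⌊ m /2⌋ * r) e ⟩
        e + ⌊ m /2⌋ * r   <⟨ +-monoˡ-≤ (⌊ m /2⌋ * r) e≤r ⟩
        r + ⌊ m /2⌋ * r   ≤⟨ lt ⟩
        count (P? ∘ suc)  ∎))
      where open ≤-Reasoning

    run-out : ∀ {n} m r e {P : Pred (Fin n) 0ℓ} (P? : Decidable P) →
              FailsEvery (suc r) e P → e ≤ r → ⌊ m /2⌋ * r + e < count P? →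
              AlternatingSubsequence (suc m) (∁ P) P
    run-out {suc n} m r e P? F e≤r lt with P? zero
    run-out {suc n} m r zero    P? F e≤r lt | no ¬p =
      keep ¬p (alternation m r r (P? ∘ suc) (fails-wrap F) ≤-refl (≤-<-trans (m≤m+n _ _) lt))
    run-out {suc n} m r (suc e) P? F e≤r lt | no ¬p =
      keep ¬p (alternation m r e (P? ∘ suc) (fails-tail F) (<⇒≤ e≤r) (≤-<-trans (m≤m+n _ _) lt))
    run-out {suc n} m r zero    P? F e≤r lt | yes p = contradiction p (F zero 0 refl)
    run-out {suc n} m r (suc e) P? F e≤r lt | yes p =
      skip (run-out m r e (P? ∘ suc) (fails-tail F) (<⇒≤ e≤r) (ℕ.s<s⁻¹ (≡.subst (_< suc (count (P? ∘ suc))) (+-suc (⌊ m /2⌋ * r) e) lt)))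

  -- Union bound, by induction on the indices: at least one predicate counts the first index.
  n≤∑count : ∀ {m n} {P : Fin m → Pred (Fin n) 0ℓ} (P? : ∀ a → Decidable (P a)) →
             (∀ j → ∃ λ a → P a j) → n ≤ sum (λ a → count (P? a))
  n≤∑count {n = zero}  P? cover = z≤n
  n≤∑count {n = suc n} P? cover = begin
    1 + n
      ≤⟨ +-mono-≤ head≥1 (n≤∑count (λ a → P? a ∘ suc) (cover ∘ suc)) ⟩
    sum (λ a → indicator (P? a zero)) + sum (λ a → count (P? a ∘ suc))     ≡⟨ ∑-distrib-+ (λ a → indicator (P? a zero)) (λ a → count (P? a ∘ suc)) ⟨
    sum (λ a → count (P? a))                                               ∎
    where
    open ≤-Reasoning
    term≤sum : ∀ {m} (x : Vector ℕ m) a → x a ≤ sum x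
    term≤sum x zero    = m≤m+n _ _
    term≤sum x (suc a) = ≤-trans (term≤sum (x ∘ suc) a) (m≤n+m _ _)
    indicator≥1 : ∀ {A : Set} (A? : Dec A) → A → 1 ≤ indicator A?
    indicator≥1 (yes _) _ = ≤-refl
    indicator≥1 (no ¬a) a = contradiction a ¬a
    head≥1 : 1 ≤ sum (λ a → indicator (P? a zero))
    head≥1 with cover zero
    ... | a , p = ≤-trans (indicator≥1 (P? a zero) p) (term≤sum (λ a → indicator (P? a zero)) a)

  sum≤* : ∀ {m} B (x : Vector ℕ m) → (∀ a → x a ≤ B) → sum x ≤ m * B
  sum≤* {zero}  B x x≤B = z≤n
  sum≤* {suc m} B x x≤B = +-mono-≤ (x≤B zero) (sum≤* B (x ∘ suc) (x≤B ∘ suc))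

  cover⇒n≤* : ∀ {m n} B {P : Fin m → Pred (Fin n) 0ℓ} (P? : ∀ a → Decidable (P a)) →
                 (∀ a → count (P? a) ≤ B) → (∀ j → ∃ λ a → P a j) → n ≤ m * B
  cover⇒n≤* B P? count≤B cover = ≤-trans (n≤∑count P? cover) (sum≤* B _ count≤B)

open Combinatorics

-- Determinants by Laplace expansion.

-- A pair `(j , k)` encodes the ordered pair of distinct columns `j` and `punchIn j k`. The pair
-- `(punchIn j k , pinch k j)` encodes the same two columns in the opposite order.
punchIn-punchIn-pinch : ∀ {m} (j : Fin (suc m)) (k : Fin m) → punchIn (punchIn j k) (pinch k j) ≡ j
punchIn-punchIn-pinch zero    (suc k) = ≡.refl
punchIn-punchIn-pinch zero    zero    = ≡.refl
punchIn-punchIn-pinch (suc j) zero    = ≡.refl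
punchIn-punchIn-pinch (suc j) (suc k) = ≡.cong suc (punchIn-punchIn-pinch j k)

-- The columns that remain, and their order, do not depend on which of the two columns is deleted
-- first.
punchIn-punchIn-comm : ∀ {m} (j : Fin (suc (suc m))) k (l : Fin m) →
  punchIn (punchIn j k) (punchIn (pinch k j) l) ≡ punchIn j (punchIn k l)
punchIn-punchIn-comm zero    zero    l       = ≡.refl
punchIn-punchIn-comm zero    (suc k) l       = ≡.refl
punchIn-punchIn-comm (suc j) zero    l       = ≡.refl
punchIn-punchIn-comm (suc j) (suc k) zero    = ≡.refl
punchIn-punchIn-comm (suc j) (suc k) (suc l) = ≡.cong suc (punchIn-punchIn-comm j k l)

swap₀₁ : ∀ {m} → Fin (suc (suc m)) → Fin (suc (suc m))
swap₀₁ zero          = suc zero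
swap₀₁ (suc zero)    = zero
swap₀₁ (suc (suc a)) = suc (suc a)

module Determinant (ℝ : RealNumbers) where
  open RealNumbers ℝ hiding (zero)
  open OrderedField ℝ
  open LinearAlgebra ℝ
  open RingProperties ring
  open SemiringSum semiring
  open SemiringExp semiring using (_^_)
  open IntegerSolver commutativeRing
  open SetoidReasoning setoid

  sgn : ℕ → Carrier
  sgn n = (- 1#) ^ n

  sgn-suc : ∀ n → sgn (suc n) ≈ - sgn n
  sgn-suc n = -1*x≈-x (sgn n)

  det-cong : ∀ {m} {M M′ : Fin m → Fin m → Carrier} → (∀ a b → M a b ≈ M′ a b) → det ℝ M ≈ det ℝ M′
  det-cong {zero}  M≈ = refl
  det-cong {suc m} M≈ = sum-cong-≋ λ j →
    *-congˡ {x = sgn (toℕ j)} (*-cong (M≈ zero j) (det-cong λ a b → M≈ (suc a) (punchIn j b)))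

  -- Exchanging the two columns permutes the ordered pairs. Pairs whose first column is zero trade
  -- places with those whose second is zero; the rest is the induction hypothesis.
  ∑-punchIn-pinch : ∀ {m} (φ : Fin (suc m) → Fin m → Carrier) →
    sum (λ j → sum λ k → φ j k) ≈ sum (λ j → sum λ k → φ (punchIn j k) (pinch k j))
  ∑-punchIn-pinch {zero}  φ = refl
  ∑-punchIn-pinch {suc m} φ = begin
    sum (φ zero) + sum (λ j → φ (suc j) zero + sum (λ k → φ (suc j) (suc k)))
      ≈⟨ +-congˡ (∑-distrib-+ (λ j → φ (suc j) zero) (λ j → sum λ k → φ (suc j) (suc k))) ⟩
    sum (φ zero) + (sum (λ j → φ (suc j) zero) + sum (λ j → sum λ k → φ (suc j) (suc k)))
      ≈⟨ solve 3 (λ x y z → x :+ (y :+ z) := y :+ (x :+ z)) refl (sum (φ zero)) (sum λ j → φ (suc j) zero) _ ⟩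
    sum (λ j → φ (suc j) zero) + (sum (φ zero) + sum (λ j → sum λ k → φ (suc j) (suc k)))
      ≈⟨ +-congˡ (+-congˡ (∑-punchIn-pinch λ j k → φ (suc j) (suc k))) ⟩
    sum (λ j → φ (suc j) zero) + (sum (φ zero) + sum (λ j → sum λ k → φ (suc (punchIn j k)) (suc (pinch k j))))
      ≈⟨ +-congˡ (∑-distrib-+ (φ zero) (λ j → sum λ k → φ (suc (punchIn j k)) (suc (pinch k j)))) ⟨
    sum (λ j → φ (suc j) zero) + sum (λ j → φ zero j + sum (λ k → φ (suc (punchIn j k)) (suc (pinch k j)))) ∎

  -- The exchange changes the sum of the two deletion indices by exactly one.
  sgn-punchIn-pinch : ∀ {m} (j : Fin (suc m)) (k : Fin m) →
    sgn (toℕ (punchIn j k)) * sgn (toℕ (pinch k j)) ≈ - (sgn (toℕ j) * sgn (toℕ k))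
  sgn-punchIn-pinch {suc m} zero k = begin
    sgn (suc (toℕ k)) * 1#      ≈⟨ *-identityʳ _ ⟩
    sgn (suc (toℕ k))           ≈⟨ sgn-suc (toℕ k) ⟩
    - sgn (toℕ k)               ≈⟨ -‿cong (*-identityˡ _) ⟨
    - (1# * sgn (toℕ k))        ∎
  sgn-punchIn-pinch (suc j) zero = begin
    1# * sgn (toℕ j)                  ≈⟨ *-identityˡ _ ⟩
    sgn (toℕ j)                       ≈⟨ -‿involutive _ ⟨
    - - sgn (toℕ j)                   ≈⟨ -‿cong (sgn-suc (toℕ j)) ⟨
    - sgn (suc (toℕ j))               ≈⟨ -‿cong (*-identityʳ _) ⟨
    - (sgn (suc (toℕ j)) * 1#)        ∎
  sgn-punchIn-pinch (suc j) (suc k) = begin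
    sgn (suc p) * sgn (suc q)                           ≈⟨ sgn-suc² p q ⟩
    sgn p * sgn q                                       ≈⟨ sgn-punchIn-pinch j k ⟩
    - (sgn (toℕ j) * sgn (toℕ k))                       ≈⟨ -‿cong (sgn-suc² (toℕ j) (toℕ k)) ⟨
    - (sgn (suc (toℕ j)) * sgn (suc (toℕ k)))           ∎
    where
    p = toℕ (punchIn j k)
    q = toℕ (pinch k j)
    sgn-suc² : ∀ p q → sgn (suc p) * sgn (suc q) ≈ sgn p * sgn q
    sgn-suc² p q = trans (*-cong (sgn-suc p) (sgn-suc q))
      (solve 2 (λ x y → (:- x) :* (:- y) := x :* y) refl (sgn p) (sgn q))

  -- Expansion along the first two rows gives a sum over ordered pairs of distinct columns. Each
  -- term is minus the term of the exchanged pair for the swapped matrix.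
  det-swap : ∀ {m} (M : Fin (suc (suc m)) → Fin (suc (suc m)) → Carrier) → det ℝ M ≈ - det ℝ (M ∘ swap₀₁)
  det-swap {m} M = begin
    det ℝ M                                                                     ≈⟨ expand M ⟩
    sum (λ j → sum λ k → term M j k)                                            ≈⟨ sum-cong-≋ (λ j → trans (sum-cong-≋ λ k → term-swap j k) (sum-neg λ k → term M∘swap (punchIn j k) (pinch k j))) ⟩
    sum (λ j → - sum λ k → term M∘swap (punchIn j k) (pinch k j))              ≈⟨ sum-neg (λ j → sum λ k → term M∘swap (punchIn j k) (pinch k j)) ⟩
    - sum (λ j → sum λ k → term M∘swap (punchIn j k) (pinch k j))              ≈⟨ -‿cong (∑-punchIn-pinch (term M∘swap)) ⟨
    - sum (λ j → sum λ k → term M∘swap j k)                                     ≈⟨ -‿cong (expand M∘swap) ⟨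
    - det ℝ M∘swap                                                              ∎
    where
    M∘swap = M ∘ swap₀₁

    minor : Fin (suc (suc m)) → Fin (suc m) → Carrier
    minor j k = det ℝ λ a b → M (suc (suc a)) (punchIn j (punchIn k b))

    inner term : (Fin (suc (suc m)) → Fin (suc (suc m)) → Carrier) → Fin (suc (suc m)) → Fin (suc m) → Carrier
    inner M j k = sgn (toℕ k) * (M (suc zero) (punchIn j k) *
                    det ℝ λ a b → M (suc (suc a)) (punchIn j (punchIn k b)))
    term M j k = sgn (toℕ j) * (M zero j * inner M j k)

    expand : ∀ M → det ℝ M ≈ sum (λ j → sum λ k → term M j k)
    expand M = sum-cong-≋ λ j → trans
      (*-congˡ {x = sgn (toℕ j)} (*-distribˡ-sum (M zero j) (inner M j)))
      (*-distribˡ-sum (sgn (toℕ j)) λ k → M zero j * inner M j k)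

    term-swap : ∀ j k → term M j k ≈ - term M∘swap (punchIn j k) (pinch k j)
    term-swap j k = begin
      sgn (toℕ j) * (M₀ * (sgn (toℕ k) * (M₁ * minor j k)))
        ≈⟨ solve 5 (λ s x t y d → s :* (x :* (t :* (y :* d))) := :- (:- (s :* t) :* (y :* (x :* d)))) refl
                   (sgn (toℕ j)) M₀ (sgn (toℕ k)) M₁ (minor j k) ⟩
      - (- (sgn (toℕ j) * sgn (toℕ k)) * (M₁ * (M₀ * minor j k)))
        ≈⟨ -‿cong (*-congʳ (sgn-punchIn-pinch j k)) ⟨
      - (sgn (toℕ p) * sgn (toℕ q) * (M₁ * (M₀ * minor j k)))
        ≈⟨ -‿cong (solve 5 (λ s x t y d → s :* t :* (x :* (y :* d)) := s :* (x :* (t :* (y :* d)))) refl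
                   (sgn (toℕ p)) M₁ (sgn (toℕ q)) M₀ (minor j k)) ⟩
      - (sgn (toℕ p) * (M₁ * (sgn (toℕ q) * (M₀ * minor j k))))
        ≈⟨ -‿cong (*-congˡ (*-congˡ (*-congˡ (*-cong
             (reflexive (≡.cong (M zero) (punchIn-punchIn-pinch j k)))
             (det-cong λ a b → reflexive (≡.cong (M (suc (suc a))) (punchIn-punchIn-comm j k b))))))) ⟨
      - term M∘swap p q ∎
      where
      p = punchIn j k
      q = pinch k j
      M₀ = M zero j
      M₁ = M (suc zero) (punchIn j k)

  -- If the equal rows are the first two, swapping them changes the sign but not the matrix.
  -- Otherwise the swap moves row zero into second place, and every minor of the expansion has equal
  -- rows that are one step closer.
  det-repeat : ∀ {m} (M : Fin (suc m) → Fin (suc m) → Carrier) (a : Fin m) →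
               (∀ b → M zero b ≈ M (suc a) b) → det ℝ M ≈ 0#
  det-repeat M zero eq = x+x≈0⇒x≈0 (begin
    det ℝ M + det ℝ M                  ≈⟨ +-congʳ (det-swap M) ⟩
    - det ℝ (M ∘ swap₀₁) + det ℝ M     ≈⟨ +-congʳ (-‿cong (det-cong swapped)) ⟩
    - det ℝ M + det ℝ M                ≈⟨ -‿inverseˡ _ ⟩
    0#                                 ∎)
    where
    swapped : ∀ a b → M (swap₀₁ a) b ≈ M a b
    swapped zero          b = sym (eq b)
    swapped (suc zero)    b = eq b
    swapped (suc (suc a)) b = refl
  det-repeat M (suc a) eq = begin
    det ℝ M                  ≈⟨ det-swap M ⟩
    - det ℝ (M ∘ swap₀₁)
      ≈⟨ -‿cong (sum-zero λ j → trans (*-congˡ {x = sgn (toℕ j)} (trans (*-congˡ {x = M (suc zero) j} (minor≈0 j)) (zeroʳ _))) (zeroʳ _)) ⟩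
    - 0#                     ≈⟨ -0#≈0# ⟩
    0#                       ∎
    where
    minor≈0 : ∀ j → det ℝ (λ a b → M (swap₀₁ (suc a)) (punchIn j b)) ≈ 0#
    minor≈0 j = det-repeat (λ a b → M (swap₀₁ (suc a)) (punchIn j b)) a (λ b → eq (punchIn j b))

  -- Cramer's linear dependency of m + 1 vectors in dimension m, tested against f.
  cramer : ∀ {m} (V : Fin (suc m) → Vector Carrier m) (f : Vector Carrier m) →
           sum (λ a → sgn (toℕ a) * (dot (V a) f * det ℝ λ i b → V (punchIn a b) i)) ≈ 0#
  cramer {m} V f = begin
    sum (λ a → sgn (toℕ a) * (dot (V a) f * D a))
      ≈⟨ sum-cong-≋ (λ a → trans
             (*-congˡ {x = sgn (toℕ a)} (*-distribʳ-sum (D a) λ i → V a i * f i))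
             (*-distribˡ-sum (sgn (toℕ a)) λ i → V a i * f i * D a)) ⟩
    sum (λ a → sum λ i → sgn (toℕ a) * (V a i * f i * D a))
      ≈⟨ ∑-comm (λ a i → sgn (toℕ a) * (V a i * f i * D a)) ⟩
    sum (λ i → sum λ a → sgn (toℕ a) * (V a i * f i * D a))
      ≈⟨ sum-zero (λ i → begin
           sum (λ a → sgn (toℕ a) * (V a i * f i * D a))
             ≈⟨ sum-cong-≋ (λ a → solve 4 (λ s v f d → s :* (v :* f :* d) := f :* (s :* (v :* d))) refl (sgn (toℕ a)) (V a i) (f i) (D a)) ⟩
           sum (λ a → f i * (sgn (toℕ a) * (V a i * D a)))
             ≈⟨ *-distribˡ-sum (f i) (λ a → sgn (toℕ a) * (V a i * D a)) ⟨
           f i * det ℝ (bordered i)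
             ≈⟨ *-congˡ (det-repeat (bordered i) i λ b → refl) ⟩
           f i * 0#
             ≈⟨ zeroʳ _ ⟩
           0# ∎) ⟩
    0# ∎
    where
    D : Fin (suc m) → Carrier
    D a = det ℝ λ i b → V (punchIn a b) i
    -- Coordinate `i` of all the vectors is put on top of the coordinate matrix, which already
    -- contains this row. Expansion along the top row is coordinate `i` of the dependency.
    bordered : Fin m → Fin (suc m) → Fin (suc m) → Carrier
    bordered i = (λ b → V b i) ∷ (λ a b → V b a)

  Negative Nonnegative : Carrier → Set
  Negative    x = x < 0#
  Nonnegative x = 0# ≤ x

  sum-shift : ∀ {m} (y : Vector Carrier (suc m)) →
    sum (λ a → sgn (toℕ a) * y a) ≈ y zero - sum (λ a → sgn (toℕ a) * y (suc a))
  sum-shift y = +-cong (*-identityˡ _) (trans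
    (sum-cong-≋ λ a → trans (*-congʳ {x = y (suc a)} (sgn-suc (toℕ a))) (sym (-‿distribˡ-* _ _)))
    (sum-neg λ a → sgn (toℕ a) * y (suc a)))

  mutual
    alternating-sum-nonpos : ∀ {m} (x w : Vector Carrier m) → (∀ a → 0# < w a) →
      Alternating Negative Nonnegative x → sum (λ a → sgn (toℕ a) * (x a * w a)) ≤ 0#
    alternating-sum-nonpos {zero}  x w 0<w _ = inj₂ refl
    alternating-sum-nonpos {suc m} x w 0<w alt = inj₁ (alternating-sum-neg x w 0<w alt)

    -- The signs of `sgn` and of `x` alternate in step, so no term is positive, and the first one is
    -- strictly negative.
    alternating-sum-neg : ∀ {m} (x w : Vector Carrier (suc m)) → (∀ a → 0# < w a) →
      Alternating Negative Nonnegative x → sum (λ a → sgn (toℕ a) * (x a * w a)) < 0#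
    alternating-sum-neg x w 0<w (x<0 , alt) = neg-pos⁻¹ (<-respʳ-≈ (sym (trans (-‿cong (sum-shift λ a → x a * w a))
        (solve 3 (λ x w s → :- (x :* w :- s) := :- x :* w :+ s) refl (x zero) (w zero) _)))
      (pos+nonneg (*-pos (neg-pos x<0) (0<w zero)) (alternating-sum-nonneg (x ∘ suc) (w ∘ suc) (0<w ∘ suc) alt)))

    alternating-sum-nonneg : ∀ {m} (x w : Vector Carrier m) → (∀ a → 0# < w a) →
      Alternating Nonnegative Negative x → 0# ≤ sum (λ a → sgn (toℕ a) * (x a * w a))
    alternating-sum-nonneg {zero}  x w 0<w _ = inj₂ refl
    alternating-sum-nonneg {suc m} x w 0<w (0≤x , alt) = ≤-respʳ (sym (sum-shift λ a → x a * w a))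
      (+-nonneg (*-nonneg 0≤x (inj₁ (0<w zero)))
        (nonpos-neg (alternating-sum-nonpos (x ∘ suc) (w ∘ suc) (0<w ∘ suc) alt)))

-- Sarkaria's tensor construction and its dual functionals.

module SarkariaTensor (ℝ : RealNumbers) where
  open RealNumbers ℝ hiding (zero)
  open LinearAlgebra ℝ
  open RingProperties ring
  open SemiringSum semiring
  open IntegerSolver commutativeRing
  open SetoidReasoning setoid

  sum-++ : ∀ m {n} (x : Vector Carrier (m ℕ.+ n)) → sum x ≈ sum (λ i → x (i ↑ˡ n)) + sum (λ j → x (m ↑ʳ j))
  sum-++ zero    x = sym (+-identityˡ _)
  sum-++ (suc m) x = trans (+-congˡ (sum-++ m (x ∘ suc))) (sym (+-assoc _ _ _))

  sum-remQuot : ∀ m {n} (x : Fin m → Fin n → Carrier) →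
                sum (λ k → uncurry x (remQuot {m} n k)) ≈ sum (λ i → sum (x i))
  sum-remQuot zero        x = refl
  sum-remQuot (suc m) {n} x = trans (sum-++ n (λ k → uncurry x (remQuot {suc m} n k))) (+-cong
    (sum-cong-≋ λ j → reflexive (≡.cong (uncurry x) (Fin.remQuot-combine {suc m} zero j)))
    (trans (sum-cong-≋ λ k → reflexive (≡.cong (uncurry x) (remQuot-↑ʳ k))) (sum-remQuot m (x ∘ suc))))
    where
    remQuot-↑ʳ : ∀ k → remQuot {suc m} n (n ↑ʳ k) ≡ (suc (proj₁ (remQuot {m} n k)) , proj₂ (remQuot {m} n k))
    remQuot-↑ʳ k rewrite Fin.splitAt-↑ʳ n (m ℕ.* n) k = ≡.refl

  kron : ∀ {m} → Fin m → Fin m → Carrier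
  kron zero    zero    = 1#
  kron zero    (suc p) = 0#
  kron (suc i) zero    = 0#
  kron (suc i) (suc p) = kron i p

  sum-kron : ∀ {m} (p : Fin m) (y : Vector Carrier m) → sum (λ i → kron i p * y i) ≈ y p
  sum-kron zero    y = trans (+-cong (*-identityˡ _) (sum-zero λ i → zeroˡ (y (suc i)))) (+-identityʳ _)
  sum-kron (suc p) y = trans (+-cong (zeroˡ _) (sum-kron p (y ∘ suc))) (+-identityˡ _)

  -- It has two uses: as the target vector for Farkas' lemma, and as the constant functional 1 on
  -- lifted points (1, x).
  e₀ : ∀ {d} → Vector Carrier (suc d)
  e₀ = 1# ∷ λ _ → 0#

  dot-e₀ : ∀ {d} (v : Vector Carrier (suc d)) → dot v e₀ ≈ v zero
  dot-e₀ v = trans (+-cong (*-identityʳ _) (sum-zero λ i → zeroʳ (v (suc i)))) (+-identityʳ _)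

  e₀-dot : ∀ {d} (v : Vector Carrier (suc d)) → dot e₀ v ≈ v zero
  e₀-dot v = trans (+-cong (*-identityˡ _) (sum-zero λ i → zeroˡ (v (suc i)))) (+-identityʳ _)

  -- v placed in block p; a combination of such vectors equals e₀ exactly when
  -- all blocks receive the same combination and block 0 receives weight one.
  tensor : ∀ {r d} → Fin (suc r) → Vector Carrier d → Vector Carrier (suc (suc r ℕ.* d))
  tensor {r} {d} p v = kron zero p ∷ λ k → let (i , c) = remQuot {suc r} d k in (kron i p - kron zero p) * v c

  module _ r {d} (F : Vector Carrier (suc (suc r ℕ.* suc d))) where

    block : Fin (suc r) → Vector Carrier (suc d)
    block i c = F (suc (combine i c))

    -- What the blocks of `F` lack to sum to the constant functional `F zero`; `functional` adds it
    -- to block zero.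
    defect : Vector Carrier (suc d)
    defect c = F zero * e₀ c - sum λ i → block i c

    -- The affine functionals f₁, …, f_r of the proof, read off a dual vector F.
    functional : Fin (suc r) → Vector Carrier (suc d)
    functional p c = block p c + kron zero p * defect c

    sum-functional : ∀ c → sum (λ p → functional p c) ≈ F zero * e₀ c
    sum-functional c = begin
      block zero c + 1# * defect c + sum (λ p → functional (suc p) c)
        ≈⟨ +-cong (+-congˡ (*-identityˡ _)) (sum-cong-≋ λ p → trans (+-congˡ (zeroˡ _)) (+-identityʳ (block (suc p) c))) ⟩
      block zero c + defect c + sum (λ p → block (suc p) c)
        ≈⟨ solve 3 (λ x s y → x :+ (y :- (x :+ s)) :+ s := y) refl (block zero c) (sum λ p → block (suc p) c) (F zero * e₀ c) ⟩
      F zero * e₀ c ∎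

    -- The normalisation of `v` lets the scalar `F zero` be read as the value at `v` of the
    -- functional `F zero * e₀`.
    dot-tensor : ∀ p v → v zero ≈ 1# → dot (tensor p v) F ≈ dot v (functional p)
    dot-tensor p v v₀≈1 = begin
      k * F zero + sum (λ j → tensor p v (suc j) * F (suc j))
        ≈⟨ +-congˡ (sum-cong-≋ λ j → *-congˡ {x = tensor p v (suc j)} (reflexive (≡.cong (F ∘ suc) (Fin.combine-remQuot {suc r} (suc d) j)))) ⟨
      k * F zero + sum (λ j → uncurry (λ i c → (kron i p - k) * v c * block i c) (remQuot {suc r} (suc d) j))
        ≈⟨ +-congˡ (sum-remQuot (suc r) λ i c → (kron i p - k) * v c * block i c) ⟩
      k * F zero + sum (λ i → sum λ c → (kron i p - k) * v c * block i c)
        ≈⟨ +-congˡ (sum-cong-≋ λ i → trans (sum-cong-≋ λ c → *-assoc (kron i p - k) (v c) (block i c))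
                                           (sym (*-distribˡ-sum (kron i p - k) λ c → v c * block i c))) ⟩
      k * F zero + sum (λ i → (kron i p - k) * g i)
        ≈⟨ +-congˡ (sum-cong-≋ λ i → solve 3 (λ x k g → (x :- k) :* g := x :* g :+ (:- k) :* g) refl (kron i p) k (g i)) ⟩
      k * F zero + sum (λ i → kron i p * g i + - k * g i)
        ≈⟨ +-congˡ (trans (sum-+* (λ i → kron i p * g i) g (- k)) (+-congʳ (sum-kron p g))) ⟩
      k * F zero + (g p + - k * sum g)
        ≈⟨ solve 4 (λ k f g s → k :* f :+ (g :+ (:- k) :* s) := g :+ k :* (f :- s)) refl k (F zero) (g p) (sum g) ⟩
      g p + k * (F zero - sum g)
        ≈⟨ +-congˡ (*-congˡ dot-defect) ⟨
      g p + k * dot v defect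
        ≈⟨ dot-+*ʳ v (block p) defect k ⟨
      dot v (functional p) ∎
      where
      k = kron zero p
      g : Vector Carrier (suc r)
      g i = dot v (block i)
      dot-defect : dot v defect ≈ F zero - sum g
      dot-defect = begin
        sum (λ c → v c * defect c)
          ≈⟨ sum-cong-≋ (λ c → solve 4 (λ v f e s → v :* (f :* e :- s) := :- (v :* s) :+ f :* (v :* e)) refl (v c) (F zero) (e₀ c) (sum λ i → block i c)) ⟩
        sum (λ c → - (v c * sum (λ i → block i c)) + F zero * (v c * e₀ c))
          ≈⟨ sum-+* (λ c → - (v c * sum (λ i → block i c))) (λ c → v c * e₀ c) (F zero) ⟩
        sum (λ c → - (v c * sum (λ i → block i c))) + F zero * dot v e₀
          ≈⟨ +-cong (trans (sum-neg λ c → v c * sum (λ i → block i c)) (-‿cong (trans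
               (sum-cong-≋ λ c → *-distribˡ-sum (v c) λ i → block i c)
               (∑-comm λ c i → v c * block i c)))) (trans (*-congˡ (trans (dot-e₀ v) v₀≈1)) (*-identityʳ _)) ⟩
        - sum g + F zero
          ≈⟨ +-comm _ _ ⟩
        F zero - sum g ∎

-- Half-spaces meeting a homogeneous set, and the common point.

punchIn-mono-< : ∀ {n} (i : Fin (suc n)) {j k : Fin n} → j Fin.< k → punchIn i j Fin.< punchIn i k
punchIn-mono-< i {j} {k} j<k = ℕ.≰⇒> λ p → ℕ.<⇒≱ j<k (Fin.punchIn-cancel-≤ i k j p)

-- There are `suc r` parts, so `r` itself is the last factor of the bound.
module HomogeneousTverberg (ℝ : RealNumbers) {d n r : ℕ} (X : Fin n → Point ℝ d)
  (homogeneous : OrderTypeHomogeneous ℝ X)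
  (large : suc ((d ℕ.+ 1) ℕ.* (⌊ d /2⌋ ℕ.+ 1) ℕ.* r) ℕ.≤ n) where

  open RealNumbers ℝ hiding (zero)
  open OrderedField ℝ
  open LinearAlgebra ℝ
  open Determinant ℝ
  open SarkariaTensor ℝ
  open RingProperties ring
  open SemiringSum semiring
  open IntegerSolver commutativeRing
  open SetoidReasoning setoid
  open OrderTypeHomogeneous homogeneous

  -- Affine functionals become linear on lifted points, and these are the columns of the orientation
  -- determinants.
  lift : Fin n → Vector Carrier (suc d)
  lift j = 1# ∷ X j

  -- Homogeneity gives all minors of the chosen points the same sign, so the Cramer dependency
  -- evaluated under `f` admits no cancellation.
  no-alternation : (f : Vector Carrier (suc d)) →
    ¬ AlternatingSubsequence (suc (suc d)) (λ j → dot (lift j) f < 0#) (∁ λ j → dot (lift j) f < 0#)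
  no-alternation f (s , increasing , alternating) = impossible sameOrientation
    where
    minor : Fin (suc (suc d)) → Carrier
    minor a = det ℝ (homogenize ℝ λ b → X (s (punchIn a b)))

    minor≈ : ∀ a → det ℝ (λ i b → lift (s (punchIn a b)) i) ≈ minor a
    minor≈ a = det-cong {M = λ i b → lift (s (punchIn a b)) i} {homogenize ℝ λ b → X (s (punchIn a b))} λ { zero b → refl ; (suc i) b → refl }

    x : Vector Carrier (suc (suc d))
    x a = dot (lift (s a)) f

    dependency : sum (λ a → sgn (toℕ a) * (x a * minor a)) ≈ 0#
    dependency = trans (sum-cong-≋ λ a → *-congˡ {x = sgn (toℕ a)} (*-congˡ {x = x a} (sym (minor≈ a)))) (cramer (lift ∘ s) f)

    alternating′ : Alternating Negative Nonnegative x
    alternating′ = alternating-map (λ j → dot (lift j) f) id ≮⇒≥ s alternating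

    impossible : _ → _
    impossible (inj₁ 0<det) = <-irrefl dependency
      (alternating-sum-neg x minor (λ a → 0<det (s ∘ punchIn a) λ b<c → increasing (punchIn-mono-< a b<c)) alternating′)
    -- For negative orientation the dependency is negated, which makes the weights positive.
    impossible (inj₂ det<0) = <-irrefl
      (begin
        sum (λ a → sgn (toℕ a) * (x a * - minor a))      ≈⟨ sum-cong-≋ (λ a → solve 3 (λ s x m → s :* (x :* (:- m)) := :- (s :* (x :* m))) refl (sgn (toℕ a)) (x a) (minor a)) ⟩
        sum (λ a → - (sgn (toℕ a) * (x a * minor a)))    ≈⟨ sum-neg (λ a → sgn (toℕ a) * (x a * minor a)) ⟩
        - sum (λ a → sgn (toℕ a) * (x a * minor a))      ≈⟨ -‿cong dependency ⟩
        - 0#                                             ≈⟨ -0#≈0# ⟩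
        0#                                               ∎)
      (alternating-sum-neg x (λ a → - minor a)
        (λ a → neg-pos (det<0 (s ∘ punchIn a) λ b<c → increasing (punchIn-mono-< a b<c))) alternating′)

  part : Fin n → Fin (suc r)
  part j = toℕ j mod suc r

  toℕ-part : ∀ j → toℕ (part j) ≡ toℕ j % suc r
  toℕ-part j = Fin.toℕ-fromℕ< (m%n<n (toℕ j) (suc r))

  -- Part `i` consists of the indices `i`, `i + (r + 1)`, and so on, at none of which `f` is
  -- negative. The count `alternation` allows for d + 2 alternating points is ⌊(d + 2)/2⌋ r, which
  -- is the stated bound.
  count-negative : ∀ i (f : Vector Carrier (suc d)) → (∀ j → part j ≡ i → 0# ≤ dot (lift j) f) →
                   count (λ j → dot (lift j) f <? 0#) ℕ.≤ suc ⌊ d /2⌋ ℕ.* r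
  count-negative i f 0≤f = ℕ.≮⇒≥ λ lt → no-alternation f
    (alternation (suc (suc d)) r (toℕ i) (λ j → dot (lift j) f <? 0#) fails (ℕ.s≤s⁻¹ (Fin.toℕ<n i)) lt)
    where
    fails : FailsEvery (suc r) (toℕ i) (λ j → dot (lift j) f < 0#)
    fails j t eq = ≤⇒≯ (0≤f j (Fin.toℕ-injective (≡.trans (toℕ-part j) (≡.trans (≡.cong (_% suc r) eq)
      (≡.trans ([m+kn]%n≡m%n (toℕ i) t (suc r)) (m<n⇒m%n≡m (Fin.toℕ<n i)))))))

  -- The functional `κ * e₀`, being the sum of all `f i`, lies in their cone. Carathéodory's theorem
  -- in dimension d + 1 keeps at most d + 1 of them, whence the first factor of the bound.
  no-separation : (f : Fin (suc r) → Vector Carrier (suc d)) (κ : Carrier) → κ < 0# →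
                  (∀ c → sum (λ i → f i c) ≈ κ * e₀ c) → ¬ (∀ j → 0# ≤ dot (lift j) (f (part j)))
  no-separation f κ κ<0 sum-f 0≤f = contradict (carathéodory (suc r) f (λ c → κ * e₀ c)
      ((λ _ → 1#) , (λ _ → inj₁ 0<1) , λ c → trans (sym (sum-f c)) (sum-cong-≋ λ i → sym (*-identityˡ (f i c)))))
    where
    contradict : ¬ ∃ λ m → m ℕ.≤ suc d × Σ (Fin m → Fin (suc r)) λ s → InCone (f ∘ s) (λ c → κ * e₀ c)
    contradict (m , m≤1+d , s , u , 0≤u , κe₀≈) = ℕ.<⇒≱ large n≤
      where
      cover : ∀ j → ∃ λ a → dot (lift j) (f (s a)) < 0#
      cover j with Fin.any? (λ a → dot (lift j) (f (s a)) <? 0#)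
      ... | yes p = p
      -- Were no chosen functional negative at this point, their nonnegative combination, whose
      -- value there is `κ`, would be nonnegative.
      ... | no ∄a = contradiction κ<0 (≤⇒≯ (≤-respʳ total (sum-nonneg λ a → *-nonneg (0≤u a) (≮⇒≥ λ lt → ∄a (a , lt)))))
        where
        total : sum (λ a → u a * dot (lift j) (f (s a))) ≈ κ
        total = begin
          sum (λ a → u a * dot (lift j) (f (s a)))                       ≈⟨ sum-cong-≋ (λ a → *-distribˡ-sum (u a) λ c → lift j c * f (s a) c) ⟩
          sum (λ a → sum λ c → u a * (lift j c * f (s a) c))             ≈⟨ ∑-comm (λ a c → u a * (lift j c * f (s a) c)) ⟩
          sum (λ c → sum λ a → u a * (lift j c * f (s a) c))             ≈⟨ sum-cong-≋ (λ c → trans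
            (sum-cong-≋ λ a → solve 3 (λ u l f → u :* (l :* f) := l :* (u :* f)) refl (u a) (lift j c) (f (s a) c))
            (trans (sym (*-distribˡ-sum (lift j c) λ a → u a * f (s a) c))
              (trans (*-congˡ {x = lift j c} (sym (κe₀≈ c))) (solve 3 (λ l k e → l :* (k :* e) := k :* (l :* e)) refl (lift j c) κ (e₀ c))))) ⟩
          sum (λ c → κ * (lift j c * e₀ c))                              ≈⟨ *-distribˡ-sum κ (λ c → lift j c * e₀ c) ⟨
          κ * dot (lift j) e₀                                            ≈⟨ *-congˡ (dot-e₀ (lift j)) ⟩
          κ * 1#                                                         ≈⟨ *-identityʳ κ ⟩
          κ                                                              ∎

      n≤ : n ℕ.≤ (d ℕ.+ 1) ℕ.* (⌊ d /2⌋ ℕ.+ 1) ℕ.* r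
      n≤ = ℕ.≤-trans
        (cover⇒n≤* _ (λ a j → dot (lift j) (f (s a)) <? 0#)
          (λ a → count-negative (s a) (f (s a)) (0≤f′ a)) cover)
        (ℕ.≤-trans (ℕ.*-monoˡ-≤ (suc ⌊ d /2⌋ ℕ.* r) m≤1+d) (ℕ.≤-reflexive
          (≡.trans (≡.sym (ℕ.*-assoc (suc d) (suc ⌊ d /2⌋) r))
            (≡.cong₂ (λ x y → x ℕ.* y ℕ.* r) (ℕ.+-comm 1 d) (ℕ.+-comm 1 ⌊ d /2⌋)))))
        where
        0≤f′ : ∀ a j → part j ≡ s a → 0# ≤ dot (lift j) (f (s a))
        0≤f′ a j eq = ≡.subst (λ i → 0# ≤ dot (lift j) (f i)) eq (0≤f j)

  -- Farkas' lemma is applied to one tensor per point, placed according to its part. A conic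
  -- representation of `e₀` yields the convex weights for all parts at once; a separating vector
  -- yields functionals excluded by `no-separation`.
  commonPoint : Satisfiable (⋂ (Fin (suc r)) λ i → conv ℝ (alternatingPart ℝ X (suc r) i))
  commonPoint with farkas n (λ j → tensor (part j) (lift j)) e₀
  ... | inj₂ (F , 0≤aF , e₀F<0) = contradiction
          (λ j → ≤-respʳ (dot-tensor r F (part j) (lift j) refl) (0≤aF j))
          (no-separation (functional r F) (F zero) (<-respˡ-≈ (e₀-dot F) e₀F<0) (sum-functional r F))
  ... | inj₁ (w , 0≤w , e₀≈) = (λ c → total zero (suc c)) , λ i →
          n , weight i , point i , weight-nonneg i , total-weight i , point∈ i , point≈ i
    where
    weight : Fin (suc r) → Vector Carrier n
    weight i j = w j * kron i (part j)

    total : Fin (suc r) → Vector Carrier (suc d)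
    total i c = sum λ j → weight i j * lift j c

    -- Block `i` of the weighted sum of tensors is the difference `total i - total zero`, and the
    -- corresponding coordinates of `e₀` are zero.
    balanced : ∀ i c → total i c ≈ total zero c
    balanced i c = begin
      total i c
        ≈⟨ sum-cong-≋ (λ j → solve 4 (λ w x k v → w :* x :* v := w :* k :* v :+ w :* ((x :- k) :* v)) refl
             (w j) (kron i (part j)) (kron zero (part j)) (lift j c)) ⟩
      sum (λ j → weight zero j * lift j c + w j * ((kron i (part j) - kron zero (part j)) * lift j c))
        ≈⟨ ∑-distrib-+ (λ j → weight zero j * lift j c) (λ j → w j * ((kron i (part j) - kron zero (part j)) * lift j c)) ⟩
      total zero c + sum (λ j → w j * ((kron i (part j) - kron zero (part j)) * lift j c))
        ≈⟨ +-congˡ (sum-cong-≋ λ j → *-congˡ {x = w j} (reflexive (≡.cong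
             (uncurry λ i c → (kron i (part j) - kron zero (part j)) * lift j c) (Fin.remQuot-combine i c)))) ⟨
      total zero c + sum (λ j → w j * tensor (part j) (lift j) (suc (combine i c)))
        ≈⟨ +-congˡ (e₀≈ (suc (combine i c))) ⟨
      total zero c + 0#
        ≈⟨ +-identityʳ _ ⟩
      total zero c ∎

    weight-nonneg : ∀ i j → 0# ≤ weight i j
    weight-nonneg i j = *-nonneg (0≤w j) (kron-nonneg i (part j))
      where
      kron-nonneg : ∀ {m} (i p : Fin m) → 0# ≤ kron i p
      kron-nonneg zero    zero    = inj₁ 0<1
      kron-nonneg zero    (suc p) = inj₂ refl
      kron-nonneg (suc i) zero    = inj₂ refl
      kron-nonneg (suc i) (suc p) = kron-nonneg i p

    -- Coordinate zero of the representation of `e₀` normalises part zero. The leading entries 1 of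
    -- the lifted points let `balanced` carry this to the other parts.
    total-weight : ∀ i → sum (weight i) ≈ 1#
    total-weight i = begin
      sum (weight i)      ≈⟨ sum-cong-≋ (λ j → *-identityʳ (weight i j)) ⟨
      total i zero        ≈⟨ balanced i zero ⟩
      total zero zero     ≈⟨ sum-cong-≋ (λ j → *-identityʳ (weight zero j)) ⟩
      sum (weight zero)   ≈⟨ e₀≈ zero ⟨
      1#                  ∎

    -- Ensures that every part is nonempty, since part `i` contains the point with index `i`.
    r<n : suc r ℕ.≤ n
    r<n = ℕ.≤-trans (ℕ.s≤s (ℕ.m≤n*m r ((d ℕ.+ 1) ℕ.* (⌊ d /2⌋ ℕ.+ 1)) {{nonZero}})) large
      where
      nonZero : ℕ.NonZero ((d ℕ.+ 1) ℕ.* (⌊ d /2⌋ ℕ.+ 1))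
      nonZero = ℕ.m*n≢0 (d ℕ.+ 1) (⌊ d /2⌋ ℕ.+ 1) {{ℕ.≢-nonZero (ℕ.m+1+n≢0 d)}} {{ℕ.≢-nonZero (ℕ.m+1+n≢0 ⌊ d /2⌋)}}

    -- Points outside part i carry weight zero and are replaced by the first
    -- point of part i, since conv asks every listed point to lie in the part.
    index : Fin (suc r) → Fin n → Fin n
    index i j with part j Fin.≟ i
    ... | yes _ = j
    ... | no _  = inject≤ i r<n

    point : Fin (suc r) → Fin n → Point ℝ d
    point i j = X (index i j)

    point∈ : ∀ i j → alternatingPart ℝ X (suc r) i (point i j)
    point∈ i j = index i j , congruent , λ _ → refl
      where
      congruent : toℕ (index i j) % suc r ≡ toℕ i % suc r
      congruent with part j Fin.≟ i
      ... | yes ≡.refl = ≡.sym (≡.trans (≡.cong (_% suc r) (toℕ-part j)) (m%n%n≡m%n (toℕ j) (suc r)))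
      ... | no _       = ≡.cong (_% suc r) (Fin.toℕ-inject≤ i r<n)

    kron-≢ : ∀ {m} {i p : Fin m} → ¬ (p ≡ i) → kron i p ≈ 0#
    kron-≢ {i = zero}  {zero}  p≢i = contradiction ≡.refl p≢i
    kron-≢ {i = zero}  {suc p} p≢i = refl
    kron-≢ {i = suc i} {zero}  p≢i = refl
    kron-≢ {i = suc i} {suc p} p≢i = kron-≢ (p≢i ∘ ≡.cong suc)

    weight-point : ∀ i j c → weight i j * X j c ≈ weight i j * point i j c
    weight-point i j c with part j Fin.≟ i
    ... | yes _  = refl
    ... | no p≢i = trans (vanish (X j c)) (sym (vanish (X (inject≤ i r<n) c)))
      where
      vanish : ∀ y → weight i j * y ≈ 0#
      vanish y = trans (*-congʳ (trans (*-congˡ (kron-≢ p≢i)) (zeroʳ _))) (zeroˡ _)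

    point≈ : ∀ i c → total zero (suc c) ≈ sum λ j → weight i j * point i j c
    point≈ i c = trans (sym (balanced i (suc c))) (sum-cong-≋ λ j → weight-point i j c)

open import Data.Nat using (_+_; _*_; _∸_; _≤_; _≥_)

lemma3p2 : (d r : ℕ) .{{_ : NonZero d}} .{{_ : NonZero r}} →
    Σ ℕ λ c →
    c ≤ (d + 1) * (⌊ d /2⌋ + 1) * (r ∸ 1) + 1 ×
    ((ℝ : RealNumbers) (n : ℕ) (X : Fin n → Point ℝ d) →
    OrderTypeHomogeneous ℝ X → n ≥ c →
    Satisfiable (⋂ (Fin r) (λ i → conv ℝ (alternatingPart ℝ X r i))))
lemma3p2 d zero {{_}} {{()}}
-- The constant is the bound itself; in successor form it makes `n ≥ c` literally the hypothesis
-- `large`.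
lemma3p2 d (suc r) = suc bound , ℕ.≤-reflexive (ℕ.+-comm 1 bound) , λ ℝ n X homogeneous n≥c →
  HomogeneousTverberg.commonPoint ℝ X homogeneous n≥c
  where
  bound : ℕ
  bound = (d + 1) * (⌊ d /2⌋ + 1) * r
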